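{- Let $(\Sigma,E)$ be an algebraic theory and let $(T,\eta,\mu)=(T_{\Sigma,E},\eta_{\Sigma,E},\mu_{\Sigma,E})$ be its free monad on $\mathbf{Set}$. Then the algebraic theory $(\Sigma^{\mathrm{s}},E^{\mathrm{s}})$ is an algebraic presentation of the semifree monad $(T^{\mathrm{s}},\eta^{\mathrm{s}},\mu^{\mathrm{s}})$ on $T$, i.e. the monad $T_{\Sigma^{\mathrm{s}},E^{\mathrm{s}}}$ is isomorphic (as a monad) to $T^{\mathrm{s}}$.
   Context: An algebraic signature $\Sigma$ is a set of operation symbols, each with an arity $n\in\mathbb{N}$ (written $(\mathsf{op}:n)$). $\mathrm{Var}=\{v_1,v_2,\dots\}$ is a fixed set of variables; an equation is a pair of $\Sigma$-terms over $\mathrm{Var}$; an algebraic theory $(\Sigma,E)$ is a signature with a set $E$ of equations. The free monad $T_{\Sigma,E}$ of $(\Sigma,E)$ sends a set $X$ to the set of $\Sigma$-terms over $X$ modulo the smallest congruence containing all substitution instances of equations of $E$; its unit sends $x$ to the class $\overline{x}$, and its multiplication flattens terms: $\overline{t[\overline{t_i}/v_i]}\mapsto\overline{t[t_i/v_i]}$. An algebraic theory $(\Sigma',E')$ is an algebraic presentation of a $\mathbf{Set}$-monad $M$ if $T_{\Sigma',E'}\cong M$ as monads. For a monad $(M,\eta,\mu)$ on a category with finite coproducts, the semifree monad is $M^{\mathrm{s}}=\mathrm{Id}+M$ with unit $\eta^{\mathrm{s}}=\mathrm{inl}$ and multiplication $\mu^{\mathrm{s}}=[\mathrm{id}_{\mathrm{Id}+M},\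 \mathrm{inr}\circ\mu\circ M[\eta,\mathrm{id}_M]]$. Given $(\Sigma,E)$, the theory $(\Sigma^{\mathrm{s}},E^{\mathrm{s}})$ has signature $\Sigma^{\mathrm{s}}=\Sigma\uplus\{\mathsf{a}:1\}$ and equations $E^{\mathrm{s}}$ consisting of: $\mathsf{a}\mathsf{a}v_1=\mathsf{a}v_1$; $\mathsf{a}(\mathsf{op}(v_1,\dots,v_n))=\mathsf{op}(v_1,\dots,v_n)$ and $\mathsf{op}(\mathsf{a}v_1,\dots,\mathsf{a}v_n)=\mathsf{op}(v_1,\dots,v_n)$ for every $(\mathsf{op}:n)\in\Sigma$; and $t(\mathsf{a}v_1,\dots,\mathsf{a}v_n)=s(\mathsf{a}v_1,\dots,\mathsf{a}v_n)$ for every equation $t(v_1,\dots,v_n)=s(v_1,\dots,v_n)$ in $E$. -}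

module Defs where

open import Level using (Level; _⊔_) renaming (suc to lsuc)
open import Data.Fin.Base using (Fin; toℕ)
open import Data.Nat.Base using (ℕ)
open import Data.Sum.Base using (_⊎_; inj₁; inj₂; [_,_])
open import Data.Sum.Function.Setoid using (inj₁ₛ; inj₂ₛ; [_,_]ₛ; _⊎-function_)
open import Data.Sum.Relation.Binary.Pointwise using (_⊎ₛ_; inj₁; inj₂)
open import Data.Unit.Base using (⊤; tt)
open import Function.Base using (_∘_; const)
open import Function.Bundles using (Func; Inverse; _⟶ₛ_; _⟨$⟩_)
import Function.Construct.Composition as Composition
import Function.Construct.Identity as Identity
import Function.Relation.Binary.Setoid.Equality as FuncEquality
open import Relation.Binary.Bundles using (Setoid)
open import Relation.Binary.Core using (Rel)
import Relation.Binary.Reasoning.Setoid as ≈-Reasoning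

private
  variable
    ℓ a b : Level

-- The category of sets is rendered as the category of setoids: a setoid
-- stands for the quotient of its carrier, a setoid map for a function
-- between quotients, and equality of maps is pointwise up to _≈_.

infixr 9 _∘ₛ_
infix  4 _≐_

idₛ : {A : Setoid ℓ ℓ} → A ⟶ₛ A
idₛ {A = A} = Identity.function A

_∘ₛ_ : {A B C : Setoid ℓ ℓ} → B ⟶ₛ C → A ⟶ₛ B → A ⟶ₛ C
g ∘ₛ f = Composition.function f g

_≐_ : {A B : Setoid ℓ ℓ} → Rel (A ⟶ₛ B) ℓ
_≐_ {A = A} {B = B} = FuncEquality._≈_ A B

record Monad (ℓ : Level) : Set (lsuc ℓ) where
  field
    F₀     : Setoid ℓ ℓ → Setoid ℓ ℓ
    F₁     : ∀ {A B} → A ⟶ₛ B → F₀ A ⟶ₛ F₀ B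
    F-resp : ∀ {A B} {f g : A ⟶ₛ B} → f ≐ g → F₁ f ≐ F₁ g
    F-id   : ∀ {A} → F₁ (idₛ {A = A}) ≐ idₛ
    F-∘    : ∀ {A B C} (g : B ⟶ₛ C) (f : A ⟶ₛ B) → F₁ (g ∘ₛ f) ≐ F₁ g ∘ₛ F₁ f

    η : ∀ X → X ⟶ₛ F₀ X
    μ : ∀ X → F₀ (F₀ X) ⟶ₛ F₀ X

    η-natural : ∀ {A B} (f : A ⟶ₛ B) → η B ∘ₛ f ≐ F₁ f ∘ₛ η A
    μ-natural : ∀ {A B} (f : A ⟶ₛ B) → μ B ∘ₛ F₁ (F₁ f) ≐ F₁ f ∘ₛ μ A

    μ-assoc     : ∀ X → μ X ∘ₛ F₁ (μ X) ≐ μ X ∘ₛ μ (F₀ X)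
    μ-identityˡ : ∀ X → μ X ∘ₛ F₁ (η X) ≐ idₛ
    μ-identityʳ : ∀ X → μ X ∘ₛ η (F₀ X) ≐ idₛ

record MonadIso (M N : Monad ℓ) : Set (lsuc ℓ) where
  private
    module M = Monad M
    module N = Monad N
  field
    iso : ∀ X → Inverse (M.F₀ X) (N.F₀ X)

  θ : ∀ X → M.F₀ X ⟶ₛ N.F₀ X
  θ X = record { to = Inverse.to (iso X) ; cong = Inverse.to-cong (iso X) }

  field
    natural    : ∀ {A B} (f : A ⟶ₛ B) → θ B ∘ₛ M.F₁ f ≐ N.F₁ f ∘ₛ θ A
    preserve-η : ∀ X → θ X ∘ₛ M.η X ≐ N.η X
    preserve-μ : ∀ X → θ X ∘ₛ M.μ X ≐ N.μ X ∘ₛ (N.F₁ (θ X) ∘ₛ θ (M.F₀ X))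

record Signature (ℓ : Level) : Set (lsuc ℓ) where
  field
    Op    : Set ℓ
    arity : Op → ℕ

open Signature public

data Term (Σ : Signature ℓ) (X : Set a) : Set (ℓ ⊔ a) where
  var : X → Term Σ X
  op  : (f : Op Σ) → (Fin (arity Σ f) → Term Σ X) → Term Σ X

infixl 8 _[_]

_[_] : {Σ : Signature ℓ} {X : Set a} {Y : Set b} →
       Term Σ X → (X → Term Σ Y) → Term Σ Y
var x   [ σ ] = σ x
op f ts [ σ ] = op f (λ i → ts i [ σ ])

-- The index i stands for the variable v₍ᵢ₊₁₎.
Var : Set
Var = ℕ

record Theory (ℓ : Level) : Set (lsuc ℓ) where
  field
    signature : Signature ℓ
    Equation  : Rel (Term signature Var) ℓ

open Theory public

module FreeMonad (Th : Theory ℓ) where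

  private
    Tm : Set a → Set (ℓ ⊔ a)
    Tm = Term (signature Th)

  -- The constructor var-cong makes the relation descend to terms over the
  -- quotient represented by X; for propositional equality it is an
  -- instance of ≈-refl.
  data Congruence (X : Setoid ℓ ℓ) : Rel (Tm (Setoid.Carrier X)) ℓ where
    axiom    : ∀ {t s} → Equation Th t s → (σ : Var → Tm (Setoid.Carrier X)) →
               Congruence X (t [ σ ]) (s [ σ ])
    var-cong : ∀ {x y} → Setoid._≈_ X x y → Congruence X (var x) (var y)
    op-cong  : ∀ f {ts ss} → (∀ i → Congruence X (ts i) (ss i)) →
               Congruence X (op f ts) (op f ss)
    ≈-refl   : ∀ {t} → Congruence X t t
    ≈-sym    : ∀ {t s} → Congruence X t s → Congruence X s t
    ≈-trans  : ∀ {t s r} → Congruence X t s → Congruence X s r → Congruence X t r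

  T₀ : Setoid ℓ ℓ → Setoid ℓ ℓ
  T₀ X = record
    { Carrier       = Tm (Setoid.Carrier X)
    ; _≈_           = Congruence X
    ; isEquivalence = record { refl = ≈-refl ; sym = ≈-sym ; trans = ≈-trans }
    }

  []-assoc : ∀ {A : Set a} {B : Set b} (X : Setoid ℓ ℓ) (t : Tm A)
             (σ : A → Tm B) (τ : B → Tm (Setoid.Carrier X)) →
             Congruence X (t [ σ ] [ τ ]) (t [ (λ x → σ x [ τ ]) ])
  []-assoc X (var x)   σ τ = ≈-refl
  []-assoc X (op f ts) σ τ = op-cong f (λ i → []-assoc X (ts i) σ τ)

  []-congʳ : ∀ {A : Set a} (X : Setoid ℓ ℓ) (t : Tm A)
             {σ τ : A → Tm (Setoid.Carrier X)} →
             (∀ x → Congruence X (σ x) (τ x)) → Congruence X (t [ σ ]) (t [ τ ])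
  []-congʳ X (var x)   σ≈τ = σ≈τ x
  []-congʳ X (op f ts) σ≈τ = op-cong f (λ i → []-congʳ X (ts i) σ≈τ)

  []-var : (X : Setoid ℓ ℓ) (t : Tm (Setoid.Carrier X)) → Congruence X (t [ var ]) t
  []-var X (var x)   = ≈-refl
  []-var X (op f ts) = op-cong f (λ i → []-var X (ts i))

  []-congˡ : {X Y : Setoid ℓ ℓ} (σ : X ⟶ₛ T₀ Y) {t s : Tm (Setoid.Carrier X)} →
             Congruence X t s → Congruence Y (t [ σ ⟨$⟩_ ]) (s [ σ ⟨$⟩_ ])
  []-congˡ {Y = Y} σ (axiom {t} {s} e τ) =
    ≈-trans ([]-assoc Y t τ (σ ⟨$⟩_))
      (≈-trans (axiom e (λ v → τ v [ σ ⟨$⟩_ ]))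
        (≈-sym ([]-assoc Y s τ (σ ⟨$⟩_))))
  []-congˡ σ (var-cong x≈y)  = Func.cong σ x≈y
  []-congˡ σ (op-cong f ps)  = op-cong f (λ i → []-congˡ σ (ps i))
  []-congˡ σ ≈-refl          = ≈-refl
  []-congˡ σ (≈-sym p)       = ≈-sym ([]-congˡ σ p)
  []-congˡ σ (≈-trans p q)   = ≈-trans ([]-congˡ σ p) ([]-congˡ σ q)

  substₛ : {X Y : Setoid ℓ ℓ} → X ⟶ₛ T₀ Y → T₀ X ⟶ₛ T₀ Y
  substₛ σ = record { to = _[ σ ⟨$⟩_ ] ; cong = []-congˡ σ }

  unit : ∀ X → X ⟶ₛ T₀ X
  unit X = record { to = var ; cong = var-cong }

  T₁ : {A B : Setoid ℓ ℓ} → A ⟶ₛ B → T₀ A ⟶ₛ T₀ B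
  T₁ {B = B} f = substₛ (unit B ∘ₛ f)

  flatten : ∀ X → T₀ (T₀ X) ⟶ₛ T₀ X
  flatten X = substₛ idₛ

  freeMonad : Monad ℓ
  freeMonad = record
    { F₀          = T₀
    ; F₁          = T₁
    ; F-resp      = λ {_} {B} f≐g t → []-congʳ B t (λ x → var-cong (f≐g x))
    ; F-id        = λ {A} t → []-var A t
    ; F-∘         = λ {_} {_} {C} g f t → ≈-sym ([]-assoc C t _ _)
    ; η           = unit
    ; μ           = flatten
    ; η-natural   = λ f x → ≈-refl
    ; μ-natural   = λ {A} {B} f t →
                      ≈-trans ([]-assoc B t _ _) (≈-sym ([]-assoc B t _ _))
    ; μ-assoc     = λ X t →
                      ≈-trans ([]-assoc X t _ _) (≈-sym ([]-assoc X t _ _))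
    ; μ-identityˡ = λ X t → ≈-trans ([]-assoc X t _ _) ([]-var X t)
    ; μ-identityʳ = λ X t → ≈-refl
    }

open FreeMonad public using (freeMonad)

_IsPresentationOf_ : Theory ℓ → Monad ℓ → Set (lsuc ℓ)
Th IsPresentationOf M = MonadIso (freeMonad Th) M

module Semifree (M : Monad ℓ) where

  open Monad M

  Fˢ₀ : Setoid ℓ ℓ → Setoid ℓ ℓ
  Fˢ₀ X = X ⊎ₛ F₀ X

  Fˢ₁ : {A B : Setoid ℓ ℓ} → A ⟶ₛ B → Fˢ₀ A ⟶ₛ Fˢ₀ B
  Fˢ₁ f = f ⊎-function F₁ f

  ηˢ : ∀ X → X ⟶ₛ Fˢ₀ X
  ηˢ X = inj₁ₛ

  [η,id] : ∀ X → Fˢ₀ X ⟶ₛ F₀ X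
  [η,id] X = [ η X , idₛ ]ₛ

  μˢ : ∀ X → Fˢ₀ (Fˢ₀ X) ⟶ₛ Fˢ₀ X
  μˢ X = [ idₛ , inj₂ₛ ∘ₛ (μ X ∘ₛ F₁ ([η,id] X)) ]ₛ

  [η,id]-natural : {A B : Setoid ℓ ℓ} (f : A ⟶ₛ B) →
                   [η,id] B ∘ₛ Fˢ₁ f ≐ F₁ f ∘ₛ [η,id] A
  [η,id]-natural         f (inj₁ x) = η-natural f x
  [η,id]-natural {B = B} f (inj₂ t) = Setoid.refl (F₀ B)

  [η,id]-μˢ : ∀ X → [η,id] X ∘ₛ μˢ X ≐ (μ X ∘ₛ F₁ ([η,id] X)) ∘ₛ [η,id] (Fˢ₀ X)
  [η,id]-μˢ X (inj₁ y) = begin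
    [η,id] X ⟨$⟩ y                             ≈⟨ μ-identityʳ X _ ⟨
    μ X ⟨$⟩ (η (F₀ X) ⟨$⟩ ([η,id] X ⟨$⟩ y))     ≈⟨ Func.cong (μ X) (η-natural ([η,id] X) y) ⟩
    μ X ⟨$⟩ (F₁ ([η,id] X) ⟨$⟩ (η (Fˢ₀ X) ⟨$⟩ y)) ∎
    where open ≈-Reasoning (F₀ X)
  [η,id]-μˢ X (inj₂ u) = Setoid.refl (F₀ X)

  semifree : Monad ℓ
  semifree = record
    { F₀          = Fˢ₀
    ; F₁          = Fˢ₁
    ; F-resp      = λ f≐g → λ where
        (inj₁ x) → inj₁ (f≐g x)
        (inj₂ t) → inj₂ (F-resp f≐g t)
    ; F-id        = λ {A} → λ where
        (inj₁ x) → inj₁ (Setoid.refl A)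
        (inj₂ t) → inj₂ (F-id t)
    ; F-∘         = λ {A} {B} {C} g f → λ where
        (inj₁ x) → inj₁ (Setoid.refl C)
        (inj₂ t) → inj₂ (F-∘ g f t)
    ; η           = ηˢ
    ; μ           = μˢ
    ; η-natural   = λ {A} {B} f x → inj₁ (Setoid.refl B)
    ; μ-natural   = μˢ-natural
    ; μ-assoc     = μˢ-assoc
    ; μ-identityˡ = μˢ-identityˡ
    ; μ-identityʳ = λ X y → Setoid.refl (Fˢ₀ X)
    }
    where
    μˢ-natural : {A B : Setoid ℓ ℓ} (f : A ⟶ₛ B) → μˢ B ∘ₛ Fˢ₁ (Fˢ₁ f) ≐ Fˢ₁ f ∘ₛ μˢ A
    μˢ-natural {B = B} f (inj₁ y) = Setoid.refl (Fˢ₀ B)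
    μˢ-natural {A} {B} f (inj₂ t) = inj₂ (begin
      μ B ⟨$⟩ (F₁ ([η,id] B) ⟨$⟩ (F₁ (Fˢ₁ f) ⟨$⟩ t))
        ≈⟨ Func.cong (μ B) (F-∘ ([η,id] B) (Fˢ₁ f) t) ⟨
      μ B ⟨$⟩ (F₁ ([η,id] B ∘ₛ Fˢ₁ f) ⟨$⟩ t)
        ≈⟨ Func.cong (μ B) (F-resp ([η,id]-natural f) t) ⟩
      μ B ⟨$⟩ (F₁ (F₁ f ∘ₛ [η,id] A) ⟨$⟩ t)
        ≈⟨ Func.cong (μ B) (F-∘ (F₁ f) ([η,id] A) t) ⟩
      μ B ⟨$⟩ (F₁ (F₁ f) ⟨$⟩ (F₁ ([η,id] A) ⟨$⟩ t))
        ≈⟨ μ-natural f _ ⟩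
      F₁ f ⟨$⟩ (μ A ⟨$⟩ (F₁ ([η,id] A) ⟨$⟩ t)) ∎)
      where open ≈-Reasoning (F₀ B)

    μˢ-assoc : ∀ X → μˢ X ∘ₛ Fˢ₁ (μˢ X) ≐ μˢ X ∘ₛ μˢ (Fˢ₀ X)
    μˢ-assoc X (inj₁ y) = Setoid.refl (Fˢ₀ X)
    μˢ-assoc X (inj₂ t) = inj₂ (begin
      μ X ⟨$⟩ (F₁ e ⟨$⟩ (F₁ (μˢ X) ⟨$⟩ t))
        ≈⟨ Func.cong (μ X) (F-∘ e (μˢ X) t) ⟨
      μ X ⟨$⟩ (F₁ (e ∘ₛ μˢ X) ⟨$⟩ t)
        ≈⟨ Func.cong (μ X) (F-resp ([η,id]-μˢ X) t) ⟩
      μ X ⟨$⟩ (F₁ ((μ X ∘ₛ F₁ e) ∘ₛ e′) ⟨$⟩ t)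
        ≈⟨ Func.cong (μ X) (F-∘ (μ X ∘ₛ F₁ e) e′ t) ⟩
      μ X ⟨$⟩ (F₁ (μ X ∘ₛ F₁ e) ⟨$⟩ (F₁ e′ ⟨$⟩ t))
        ≈⟨ Func.cong (μ X) (F-∘ (μ X) (F₁ e) _) ⟩
      μ X ⟨$⟩ (F₁ (μ X) ⟨$⟩ (F₁ (F₁ e) ⟨$⟩ (F₁ e′ ⟨$⟩ t)))
        ≈⟨ μ-assoc X _ ⟩
      μ X ⟨$⟩ (μ (F₀ X) ⟨$⟩ (F₁ (F₁ e) ⟨$⟩ (F₁ e′ ⟨$⟩ t)))
        ≈⟨ Func.cong (μ X) (μ-natural e _) ⟩
      μ X ⟨$⟩ (F₁ e ⟨$⟩ (μ (Fˢ₀ X) ⟨$⟩ (F₁ e′ ⟨$⟩ t))) ∎)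
      where
      open ≈-Reasoning (F₀ X)
      e  = [η,id] X
      e′ = [η,id] (Fˢ₀ X)

    μˢ-identityˡ : ∀ X → μˢ X ∘ₛ Fˢ₁ (ηˢ X) ≐ idₛ
    μˢ-identityˡ X (inj₁ x) = Setoid.refl (Fˢ₀ X)
    μˢ-identityˡ X (inj₂ t) = inj₂ (begin
      μ X ⟨$⟩ (F₁ ([η,id] X) ⟨$⟩ (F₁ (ηˢ X) ⟨$⟩ t))
        ≈⟨ Func.cong (μ X) (F-∘ ([η,id] X) (ηˢ X) t) ⟨
      μ X ⟨$⟩ (F₁ ([η,id] X ∘ₛ ηˢ X) ⟨$⟩ t)
        ≈⟨ Func.cong (μ X) (F-resp (λ x → Setoid.refl (F₀ X)) t) ⟩
      μ X ⟨$⟩ (F₁ (η X) ⟨$⟩ t)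
        ≈⟨ μ-identityˡ X t ⟩
      t ∎)
      where open ≈-Reasoning (F₀ X)

open Semifree public using (semifree)

_ˢⁱᵍ : Signature ℓ → Signature ℓ
Σ ˢⁱᵍ = record { Op = Op Σ ⊎ ⊤ ; arity = [ arity Σ , const 1 ] }

module _ {Σ : Signature ℓ} {X : Set a} where

  𝖺 : Term (Σ ˢⁱᵍ) X → Term (Σ ˢⁱᵍ) X
  𝖺 t = op (inj₂ tt) (λ _ → t)

  ι : Term Σ X → Term (Σ ˢⁱᵍ) X
  ι (var x)   = var x
  ι (op f ts) = op (inj₁ f) (λ i → ι (ts i))

data SemifreeEquation (Th : Theory ℓ) : Rel (Term (signature Th ˢⁱᵍ) Var) ℓ where
  𝖺𝖺  : SemifreeEquation Th (𝖺 (𝖺 (var 0))) (𝖺 (var 0))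
  𝖺op : (f : Op (signature Th)) →
        SemifreeEquation Th (𝖺 (op (inj₁ f) (λ i → var (toℕ i))))
                            (op (inj₁ f) (λ i → var (toℕ i)))
  op𝖺 : (f : Op (signature Th)) →
        SemifreeEquation Th (op (inj₁ f) (λ i → 𝖺 (var (toℕ i))))
                            (op (inj₁ f) (λ i → var (toℕ i)))
  eq𝖺 : ∀ {t s} → Equation Th t s →
        SemifreeEquation Th (ι t [ 𝖺 ∘ var ]) (ι s [ 𝖺 ∘ var ])

semifreeTheory : Theory ℓ → Theory ℓ
semifreeTheory Th = record
  { signature = signature Th ˢⁱᵍ
  ; Equation  = SemifreeEquation Th
  }

{-# OPTIONS --safe #-}

-- Erasing 𝖺 gives `collapse`, from Σˢ-terms to Σ-terms.  A variable is fixed by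
-- the isomorphism, and every other Σˢ-term is determined by its collapse: such
-- a term t satisfies 𝖺 t ≈ t, while 𝖺 t ≈ 𝖺 (ι (collapse t)) because under an
-- outer 𝖺 every inner 𝖺 can be inserted or removed.
module Submission where

open import Defs
open import Level using (Level)
open import Data.Fin.Base using (Fin; zero; toℕ; fromℕ<)
open import Data.Fin.Properties using (toℕ<n; fromℕ<-toℕ)
open import Data.Nat.Base using (ℕ)
open import Data.Nat.Properties using (_<?_)
open import Data.Product.Base using (_,_)
open import Data.Sum.Base using (_⊎_; inj₁; inj₂)
open import Data.Sum.Relation.Binary.Pointwise using (inj₁; inj₂)
open import Data.Unit.Base using (tt)
open import Function.Base using (_∘_)
open import Function.Bundles using (Func; Inverse; _⟶ₛ_; _⟨$⟩_)
open import Function.Consequences.Setoid using (strictlyInverseˡ⇒inverseˡ; strictlyInverseʳ⇒inverseʳ)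
open import Relation.Binary.Bundles using (Setoid)
open import Relation.Binary.PropositionalEquality using (_≡_; cong; sym)
open import Relation.Nullary using (yes; no; contradiction)
import Relation.Binary.Reasoning.Setoid as ≈-Reasoning

private
  variable
    ℓ a : Level

-- Axioms are instantiated at substitutions on all of `Var`, while arguments of an operation are
-- indexed by `Fin n`. The value `d` fills the indices from `n` on.
extend : {A : Set a} (n : ℕ) → A → (Fin n → A) → ℕ → A
extend n d f k with k <? n
... | yes k<n = f (fromℕ< k<n)
... | no  _   = d

extend-toℕ : {A : Set a} {n : ℕ} (d : A) (f : Fin n → A) (i : Fin n) →
             extend n d f (toℕ i) ≡ f i
extend-toℕ {n = n} d f i with toℕ i <? n
... | yes i<n = cong f (fromℕ<-toℕ i i<n)
... | no  i≮n = contradiction (toℕ<n i) i≮n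

module _ {Σ : Signature ℓ} {X : Set a} where

  collapse : Term (Σ ˢⁱᵍ) X → Term Σ X
  collapse (var x)          = var x
  collapse (op (inj₁ f) ts) = op f (λ i → collapse (ts i))
  collapse (op (inj₂ _) ts) = collapse (ts zero)

  -- Only a bare variable goes left: `𝖺 (var x)` goes right, to the unit `var x` of the free monad.
  split : Term (Σ ˢⁱᵍ) X → X ⊎ Term Σ X
  split (var x)   = inj₁ x
  split (op f ts) = inj₂ (collapse (op f ts))

module _ (Th : Theory ℓ) where

  private
    module T  = FreeMonad Th
    module Tˢ = FreeMonad (semifreeTheory Th)
    module S  = Semifree (freeMonad Th)
    Σ  = signature Th
    Σˢ = Σ ˢⁱᵍ

  open FreeMonad using (axiom; var-cong; op-cong; ≈-refl; ≈-sym; ≈-trans)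

  collapse-[] : {A : Set a} (X : Setoid ℓ ℓ) (t : Term Σˢ A)
                (σ : A → Term Σˢ (Setoid.Carrier X)) →
                T.Congruence X (collapse (t [ σ ])) (collapse t [ collapse ∘ σ ])
  collapse-[] X (var x)          σ = ≈-refl
  collapse-[] X (op (inj₁ f) ts) σ = op-cong f (λ i → collapse-[] X (ts i) σ)
  collapse-[] X (op (inj₂ _) ts) σ = collapse-[] X (ts zero) σ

  -- Through this factorisation, compatibility of `split` with the congruence passes to `collapse`.
  [η,id]-split : (X : Setoid ℓ ℓ) (t : Term Σˢ (Setoid.Carrier X)) →
                 T.Congruence X (S.[η,id] X ⟨$⟩ split t) (collapse t)
  [η,id]-split X (var x)   = ≈-refl
  [η,id]-split X (op f ts) = ≈-refl

  -- The `𝖺` around each variable keeps the instance compound even when `t` is itself a variable, so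
  -- it always lands in the right summand.
  split-ι : {A : Set a} (X : Setoid ℓ ℓ) (t : Term Σ A)
            (σ : A → Term Σˢ (Setoid.Carrier X)) →
            Setoid._≈_ (S.Fˢ₀ X) (split (ι t [ 𝖺 ∘ var ] [ σ ]))
                                 (inj₂ (t [ collapse ∘ σ ]))
  split-ι         X (var x)   σ = inj₂ ≈-refl
  split-ι {A = A} X (op f ts) σ = inj₂ (op-cong f (λ i → collapse-ι (ts i)))
    where
    collapse-ι : (t : Term Σ A) →
                 T.Congruence X (collapse (ι t [ 𝖺 ∘ var ] [ σ ])) (t [ collapse ∘ σ ])
    collapse-ι t = ≈-trans (≈-sym ([η,id]-split X (ι t [ 𝖺 ∘ var ] [ σ ])))
                           (Func.cong (S.[η,id] X) (split-ι X t σ))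

  module _ {X : Setoid ℓ ℓ} where

    open Setoid X using (Carrier)
    private
      module Xˢ = Setoid (S.Fˢ₀ X)
      infix 4 _≈_ _≈ˢ_
      _≈_  = T.Congruence X
      _≈ˢ_ = Tˢ.Congruence X

    -- Both sides of every axiom instance are compound, with equal collapses: definitionally, or by
    -- the underlying equation for `eq𝖺`. The induction is mutual since `op-cong` needs the
    -- collapses of the arguments.
    split-cong    : {t s : Term Σˢ Carrier} → t ≈ˢ s → split t Xˢ.≈ split s
    collapse-cong : {t s : Term Σˢ Carrier} → t ≈ˢ s → collapse t ≈ collapse s

    split-cong (axiom 𝖺𝖺 σ)      = Xˢ.refl
    split-cong (axiom (𝖺op f) σ) = Xˢ.refl
    split-cong (axiom (op𝖺 f) σ) = Xˢ.refl
    split-cong (axiom (eq𝖺 {t} {s} e) σ) =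
      Xˢ.trans (split-ι X t σ)
        (Xˢ.trans (inj₂ (axiom e (collapse ∘ σ))) (Xˢ.sym (split-ι X s σ)))
    split-cong (var-cong x≈y)        = inj₁ x≈y
    split-cong (op-cong (inj₁ f) ps) = inj₂ (op-cong f (λ i → collapse-cong (ps i)))
    split-cong (op-cong (inj₂ _) ps) = inj₂ (collapse-cong (ps zero))
    split-cong ≈-refl                = Xˢ.refl
    split-cong (≈-sym p)             = Xˢ.sym (split-cong p)
    split-cong (≈-trans p q)         = Xˢ.trans (split-cong p) (split-cong q)

    collapse-cong {t} {s} p =
      ≈-trans (≈-sym ([η,id]-split X t))
        (≈-trans (Func.cong (S.[η,id] X) (split-cong p)) ([η,id]-split X s))

    𝖺-cong : {t s : Term Σˢ Carrier} → t ≈ˢ s → 𝖺 t ≈ˢ 𝖺 s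
    𝖺-cong p = op-cong (inj₂ tt) (λ _ → p)

    𝖺-idem : (t : Term Σˢ Carrier) → 𝖺 (𝖺 t) ≈ˢ 𝖺 t
    𝖺-idem t = axiom 𝖺𝖺 (λ _ → t)

    op-𝖺 : ∀ f (ts : Fin (arity Σ f) → Term Σˢ Carrier) →
           op (inj₁ f) (λ i → 𝖺 (ts i)) ≈ˢ op (inj₁ f) ts
    op-𝖺 f ts = ≈-trans
      (op-cong (inj₁ f) (λ i → 𝖺-cong (Setoid.reflexive (Tˢ.T₀ X) (sym (σ-toℕ i)))))
      (≈-trans (axiom (op𝖺 f) σ)
        (op-cong (inj₁ f) (λ i → Setoid.reflexive (Tˢ.T₀ X) (σ-toℕ i))))
      where
      -- The whole term serves as default: it exists even if `f` is a constant and `Carrier` is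
      -- empty.
      σ = extend (arity Σ f) (op (inj₁ f) ts) ts
      σ-toℕ = extend-toℕ (op (inj₁ f) ts) ts

    𝖺-fixes-op : ∀ f (ts : Fin (arity Σˢ f) → Term Σˢ Carrier) → 𝖺 (op f ts) ≈ˢ op f ts
    𝖺-fixes-op (inj₁ f) ts = ≈-trans (𝖺-cong (≈-sym σ-op)) (≈-trans (axiom (𝖺op f) σ) σ-op)
      where
      σ = extend (arity Σ f) (op (inj₁ f) ts) ts
      σ-op : op (inj₁ f) (λ i → σ (toℕ i)) ≈ˢ op (inj₁ f) ts
      σ-op = op-cong (inj₁ f)
        (λ i → Setoid.reflexive (Tˢ.T₀ X) (extend-toℕ (op (inj₁ f) ts) ts i))
    -- `ts` is a function on `Fin 1`, not definitionally the constant function that `𝖺` uses; `ts≈`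
    -- bridges the two.
    𝖺-fixes-op (inj₂ _) ts =
      ≈-trans (𝖺-cong ts≈) (≈-trans (𝖺-idem (ts zero)) (≈-sym ts≈))
      where
      ts≈ : op (inj₂ tt) ts ≈ˢ 𝖺 (ts zero)
      ts≈ = op-cong (inj₂ tt) (λ where zero → ≈-refl)

    -- By `op-𝖺` an operation cannot see a `𝖺` on its arguments. This lets inductions whose
    -- hypotheses hold only under `𝖺` pass through operations.
    op-cong-𝖺 : ∀ f {ts ss : Fin (arity Σ f) → Term Σˢ Carrier} →
                (∀ i → 𝖺 (ts i) ≈ˢ 𝖺 (ss i)) → op (inj₁ f) ts ≈ˢ op (inj₁ f) ss
    op-cong-𝖺 f {ts} {ss} ps =
      ≈-trans (≈-sym (op-𝖺 f ts)) (≈-trans (op-cong (inj₁ f) ps) (op-𝖺 f ss))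

    -- Brings an instance of an equation into the shape of `eq𝖺`. The new `𝖺` at a variable is
    -- absorbed by the one outside it.
    𝖺ι-[] : {A : Set a} (t : Term Σ A) (σ : A → Term Σ Carrier) →
            𝖺 (ι (t [ σ ])) ≈ˢ 𝖺 (ι t [ 𝖺 ∘ var ] [ ι ∘ σ ])
    𝖺ι-[] (var x)   σ = ≈-sym (𝖺-idem (ι (σ x)))
    𝖺ι-[] (op f ts) σ = 𝖺-cong (op-cong-𝖺 f (λ i → 𝖺ι-[] (ts i) σ))

    -- The outer `𝖺` matters: an equation between a variable and a compound term is not preserved by
    -- `ι` alone, as `split` separates the two sides.
    𝖺ι-cong : {t s : Term Σ Carrier} → t ≈ s → 𝖺 (ι t) ≈ˢ 𝖺 (ι s)
    𝖺ι-cong (axiom {t} {s} e σ) =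
      ≈-trans (𝖺ι-[] t σ)
        (≈-trans (𝖺-cong (axiom (eq𝖺 e) (ι ∘ σ))) (≈-sym (𝖺ι-[] s σ)))
    𝖺ι-cong (var-cong x≈y) = 𝖺-cong (var-cong x≈y)
    𝖺ι-cong (op-cong f ps) = 𝖺-cong (op-cong-𝖺 f (λ i → 𝖺ι-cong (ps i)))
    𝖺ι-cong ≈-refl         = ≈-refl
    𝖺ι-cong (≈-sym p)      = ≈-sym (𝖺ι-cong p)
    𝖺ι-cong (≈-trans p q)  = ≈-trans (𝖺ι-cong p) (𝖺ι-cong q)

    collapse∘ι : (t : Term Σ Carrier) → collapse (ι t) ≈ t
    collapse∘ι (var x)   = ≈-refl
    collapse∘ι (op f ts) = op-cong f (λ i → collapse∘ι (ts i))

    𝖺ι∘collapse : (t : Term Σˢ Carrier) → 𝖺 (ι (collapse t)) ≈ˢ 𝖺 t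
    𝖺ι∘collapse (var x)          = ≈-refl
    𝖺ι∘collapse (op (inj₁ f) ts) = 𝖺-cong (op-cong-𝖺 f (λ i → 𝖺ι∘collapse (ts i)))
    𝖺ι∘collapse (op (inj₂ _) ts) =
      ≈-trans (𝖺ι∘collapse (ts zero))
        (≈-trans (op-cong (inj₂ tt) (λ where zero → ≈-refl))
          (≈-sym (𝖺-fixes-op (inj₂ tt) ts)))

    merge : Carrier ⊎ Term Σ Carrier → Term Σˢ Carrier
    merge (inj₁ x) = var x
    merge (inj₂ t) = 𝖺 (ι t)

    merge-cong : ∀ {u v} → u Xˢ.≈ v → merge u ≈ˢ merge v
    merge-cong (inj₁ x≈y) = var-cong x≈y
    merge-cong (inj₂ t≈s) = 𝖺ι-cong t≈s

    split∘merge : ∀ u → split (merge u) Xˢ.≈ u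
    split∘merge (inj₁ x) = Xˢ.refl
    split∘merge (inj₂ t) = inj₂ (collapse∘ι t)

    merge∘split : ∀ t → merge (split t) ≈ˢ t
    merge∘split (var x)   = ≈-refl
    merge∘split (op f ts) = ≈-trans (𝖺ι∘collapse (op f ts)) (𝖺-fixes-op f ts)

  splitInverse : ∀ X → Inverse (Tˢ.T₀ X) (S.Fˢ₀ X)
  splitInverse X = record
    { to        = split
    ; from      = merge {X}
    ; to-cong   = split-cong
    ; from-cong = merge-cong
    ; inverse   = strictlyInverseˡ⇒inverseˡ (Tˢ.T₀ X) (S.Fˢ₀ X) split-cong split∘merge
                , strictlyInverseʳ⇒inverseʳ (Tˢ.T₀ X) (S.Fˢ₀ X) merge-cong merge∘split
    }

  splitₛ : ∀ X → Tˢ.T₀ X ⟶ₛ S.Fˢ₀ X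
  splitₛ X = record { to = split ; cong = split-cong }

  split-natural : ∀ {A B} (f : A ⟶ₛ B) → splitₛ B ∘ₛ Tˢ.T₁ f ≐ S.Fˢ₁ f ∘ₛ splitₛ A
  split-natural {B = B} f (var x)    = Setoid.refl (S.Fˢ₀ B)
  split-natural {B = B} f t@(op _ _) =
    inj₂ (≈-trans (collapse-[] B t _) (T.[]-congʳ B (collapse t) (λ _ → ≈-refl)))

  -- For a compound outer term, collapsing the flattened term collapses the outer layer and each
  -- inner term. The latter is `[η,id]` after `split`, and separating the substitutions gives the
  -- right summand of `μˢ`.
  split-μ : ∀ X → splitₛ X ∘ₛ Tˢ.flatten X ≐
                  S.μˢ X ∘ₛ (S.Fˢ₁ (splitₛ X) ∘ₛ splitₛ (Tˢ.T₀ X))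
  split-μ X (var t)    = Setoid.refl (S.Fˢ₀ X)
  split-μ X t@(op _ _) = inj₂ (begin
    collapse (t [ idₛ {A = Tˢ.T₀ X} ⟨$⟩_ ])
      ≈⟨ collapse-[] X t _ ⟩
    collapse t [ collapse ]
      ≈⟨ T.[]-congʳ X (collapse t) ([η,id]-split X) ⟨
    collapse t [ (λ s → S.[η,id] X ⟨$⟩ split s) ]
      ≈⟨ T.[]-assoc X (collapse t) _ _ ⟨
    collapse t [ var ∘ split ] [ S.[η,id] X ⟨$⟩_ ]
      ≈⟨ T.[]-assoc X (collapse t [ var ∘ split ]) _ _ ⟨
    collapse t [ var ∘ split ] [ var ∘ (S.[η,id] X ⟨$⟩_) ] [ idₛ {A = T.T₀ X} ⟨$⟩_ ] ∎)
    where open ≈-Reasoning (T.T₀ X)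

theorem1 : ∀ {ℓ : Level} (Th : Theory ℓ) → semifreeTheory Th IsPresentationOf semifree (freeMonad Th)
theorem1 Th = record
  { iso        = splitInverse Th
  ; natural    = split-natural Th
  ; preserve-η = λ X x → inj₁ (Setoid.refl X)
  ; preserve-μ = split-μ Th
  }
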